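{- For $n \ge 3$, the closed sun graph $\overline{S_n}$ has $h(\overline{S_n}) = 2n$ if $n \le 5$, and $h(\overline{S_n}) = n + h(C_n)$ if $n > 5$, where $C_n$ is the cycle with $n$ vertices.
   Context: All graphs are finite, simple and undirected. A harmonious coloring of a graph $G$ with $k$ colors is a proper vertex coloring $c : V(G) \to \{1,\dots,k\}$ such that for every two distinct colors $i,j$ there is at most one pair of adjacent vertices colored with $i$ and $j$. The harmonious chromatic number $h(G)$ is the minimum positive integer $k$ for which $G$ has a harmonious coloring with $k$ colors. The sun graph $S_n$ is obtained from the complete graph $K_n$ on vertices $v_1,\dots,v_n$ by adding $n$ new vertices $u_1,\dots,u_n$, where $u_i$ is adjacent to $v_i$ and $v_{i+1}$ for $1 \le i \le n-1$, and $u_n$ is adjacent to $v_n$ and $v_1$. The closed sun graph $\overline{S_n}$ (the bar does not denote graph complement) is obtained from $S_n$ by adding the edges $u_iu_{i+1}$ for $1 \le i < n$ and the edge $u_nu_1$. Thus $\overline{S_n}$ has $2n$ vertices and $n(n-1)/2+3n$ edges. -}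

module Defs where

open import Data.Empty using (⊥)
open import Data.Fin.Base using (Fin; toℕ; inject₁; finToFun; funToFin)
import Data.Fin.Properties as Fin
open import Data.Nat.Base using (ℕ; zero; suc; _+_; _^_; _≤_; z≤n; s≤s)
import Data.Nat.Properties as ℕ
open import Data.Product.Base using (_×_; _,_; ∃; ∃-syntax; proj₁; proj₂)
open import Data.Sum.Base using (_⊎_; inj₁; inj₂; swap; map)
open import Function.Base using (_∘_)
open import Function.Bundles using (_↔_; Injection; Inverse)
open import Function.Construct.Identity using (↔-id)
open import Function.Construct.Symmetry using (↔-sym)
open import Function.Properties.Inverse using (Inverse⇒Injection)
open import Level using (0ℓ)
open import Relation.Binary.Core using (Rel)
import Relation.Binary.Definitions as B
open import Relation.Binary.PropositionalEquality
  using (_≡_; _≢_; _≗_; refl; sym; trans; cong; subst; ≢-sym)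
open import Relation.Nullary.Decidable
  using (Dec; yes; no; map′; via-injection; ¬?; _×-dec_; _⊎-dec_; _→-dec_)
open import Relation.Nullary.Negation using (¬_; contradiction)
import Relation.Unary as U

-- Adjacency is required to be decidable so that h below is a total function.
record Graph : Set₁ where
  infix 4 _~_ _~?_
  field
    V        : Set
    order    : ℕ
    enum     : V ↔ Fin order
    _~_      : Rel V 0ℓ
    _~?_     : B.Decidable _~_
    ~-sym    : B.Symmetric _~_
    ~-irrefl : ∀ {x} → ¬ (x ~ x)

module _ (G : Graph) where
  open Graph G

  Coloring : ℕ → Set
  Coloring k = V → Fin k

  module _ {k : ℕ} (c : Coloring k) where

    Proper : Set
    Proper = ∀ x y → x ~ y → c x ≢ c y

    EdgeColored : Fin k → Fin k → V → V → Set
    EdgeColored i j x y = x ~ y × c x ≡ i × c y ≡ j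

    -- For i ≢ j an unordered edge with colors {i , j} has exactly one
    -- orientation satisfying EdgeColored i j, so uniqueness of the ordered
    -- pair is uniqueness of the edge.
    AtMostOneEdge : Fin k → Fin k → Set
    AtMostOneEdge i j = ∀ x y x′ y′ →
      EdgeColored i j x y → EdgeColored i j x′ y′ → x ≡ x′ × y ≡ y′

    IsHarmonious : Set
    IsHarmonious = Proper × (∀ i j → i ≢ j → AtMostOneEdge i j)

  HarmoniouslyColorable : ℕ → Set
  HarmoniouslyColorable k = ∃[ c ] IsHarmonious {k} c

  IsHarmoniousChromaticNumber : ℕ → Set
  IsHarmoniousChromaticNumber k =
    (1 ≤ k × HarmoniouslyColorable k) ×
    (∀ j → 1 ≤ j × HarmoniouslyColorable j → k ≤ j)

  private
    module E = Inverse enum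

    _≟V_ : B.DecidableEquality V
    _≟V_ = via-injection (Inverse⇒Injection enum) Fin._≟_

    allV? : {P : V → Set} → U.Decidable P → Dec (∀ x → P x)
    allV? {P} P? = map′
      (λ f x → subst P (E.strictlyInverseʳ x) (f (E.to x)))
      (λ f i → f (E.from i))
      (Fin.all? (P? ∘ E.from))

    edgeColored? : ∀ {k} (c : Coloring k) i j x y → Dec (EdgeColored c i j x y)
    edgeColored? c i j x y = (x ~? y) ×-dec (c x Fin.≟ i) ×-dec (c y Fin.≟ j)

    harmonious? : ∀ {k} (c : Coloring k) → Dec (IsHarmonious c)
    harmonious? c =
      allV? (λ x → allV? λ y → (x ~? y) →-dec ¬? (c x Fin.≟ c y))
      ×-dec
      Fin.all? (λ i → Fin.all? λ j → ¬? (i Fin.≟ j) →-dec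
        allV? λ x → allV? λ y → allV? λ x′ → allV? λ y′ →
          edgeColored? c i j x y →-dec edgeColored? c i j x′ y′ →-dec
          ((x ≟V x′) ×-dec (y ≟V y′)))

    harmonious-resp : ∀ {k} {c d : Coloring k} → c ≗ d →
                      IsHarmonious c → IsHarmonious d
    harmonious-resp {k} {c} {d} c≗d (proper , unique) =
      (λ x y x~y dx≡dy →
        proper x y x~y (trans (c≗d x) (trans dx≡dy (sym (c≗d y))))) ,
      λ i j i≢j x y x′ y′ e e′ →
        unique i j i≢j x y x′ y′ (back e) (back e′)
      where
      back : ∀ {i j x y} → EdgeColored d i j x y → EdgeColored c i j x y
      back {x = x} {y} (x~y , p , q) =
        x~y , trans (c≗d x) p , trans (c≗d y) q

    colorable? : U.Decidable HarmoniouslyColorable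
    colorable? k = map′
      (λ (a , p) → decode a , p)
      (λ (c , p) → funToFin (c ∘ E.from) , harmonious-resp (decode-encode c) p)
      (Fin.any? (harmonious? ∘ decode))
      where
      decode : Fin (k ^ order) → Coloring k
      decode a = finToFun a ∘ E.to

      decode-encode : (c : Coloring k) → c ≗ decode (funToFin (c ∘ E.from))
      decode-encode c x = sym (trans
        (Fin.finToFun-funToFin (c ∘ E.from) (E.to x))
        (cong c (E.strictlyInverseʳ x)))

    injective⇒harmonious : ∀ {k} (c : Coloring k) →
                           (∀ {x y} → c x ≡ c y → x ≡ y) → IsHarmonious c
    injective⇒harmonious c inj =
      (λ x y x~y cx≡cy → ~-irrefl (subst (x ~_) (sym (inj cx≡cy)) x~y)) ,
      λ i j _ x y x′ y′ (_ , p , q) (_ , p′ , q′) →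
        inj (trans p (sym p′)) , inj (trans q (sym q′))

    colorable-1+order : HarmoniouslyColorable (suc order)
    colorable-1+order = inject₁ ∘ E.to , injective⇒harmonious (inject₁ ∘ E.to)
      (λ eq → Injection.injective (Inverse⇒Injection enum)
        (Fin.inject₁-injective eq))

    least : {P : ℕ → Set} → U.Decidable P → ∀ m → P m →
            ∃[ k ] (P k × (∀ j → P j → k ≤ j))
    least {P} P? m pm with P? 0
    ... | yes p0 = 0 , p0 , λ _ _ → z≤n
    least {P} P? zero    pm | no ¬p0 = contradiction pm ¬p0
    least {P} P? (suc m) pm | no ¬p0 =
      let k , pk , min = least {P ∘ suc} (P? ∘ suc) m pm in
      suc k , pk , λ { zero    p0 → contradiction p0 ¬p0
                     ; (suc j) pj → s≤s (min j pj) }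

  harmoniousChromaticNumber : ∃ IsHarmoniousChromaticNumber
  harmoniousChromaticNumber =
    least (λ k → (1 ℕ.≤? k) ×-dec colorable? k)
          (suc order) (s≤s z≤n , colorable-1+order)

h : Graph → ℕ
h G = proj₁ (harmoniousChromaticNumber G)

h-isHarmoniousChromaticNumber : ∀ G → IsHarmoniousChromaticNumber G (h G)
h-isHarmoniousChromaticNumber G = proj₂ (harmoniousChromaticNumber G)

module _ {n : ℕ} where
  infix 4 _⟶_ _⟶?_

  -- i ⟶ j : j is the cyclic successor of i, indices running over 0 , … , n-1.
  _⟶_ : Rel (Fin n) 0ℓ
  i ⟶ j = toℕ j ≡ suc (toℕ i) ⊎ (suc (toℕ i) ≡ n × toℕ j ≡ 0)

  _⟶?_ : B.Decidable _⟶_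
  i ⟶? j = (toℕ j ℕ.≟ suc (toℕ i)) ⊎-dec
           ((suc (toℕ i) ℕ.≟ n) ×-dec (toℕ j ℕ.≟ 0))

  ⟶-irrefl : 3 ≤ n → ∀ {i} → ¬ (i ⟶ i)
  ⟶-irrefl _ (inj₁ eq) = contradiction (sym eq) ℕ.1+n≢n
  ⟶-irrefl 3≤n (inj₂ (eq , i≡0)) with trans (sym eq) (cong suc i≡0) | 3≤n
  ... | refl | s≤s ()

  CycleAdj : Rel (Fin n) 0ℓ
  CycleAdj i j = i ⟶ j ⊎ j ⟶ i

  cycleAdj? : B.Decidable CycleAdj
  cycleAdj? i j = (i ⟶? j) ⊎-dec (j ⟶? i)

  cycleAdj-irrefl : 3 ≤ n → ∀ {i} → ¬ CycleAdj i i
  cycleAdj-irrefl 3≤n (inj₁ e) = ⟶-irrefl 3≤n e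
  cycleAdj-irrefl 3≤n (inj₂ e) = ⟶-irrefl 3≤n e

cycle : ∀ n → 3 ≤ n → Graph
cycle n 3≤n = record
  { V        = Fin n
  ; order    = n
  ; enum     = ↔-id (Fin n)
  ; _~_      = CycleAdj
  ; _~?_     = cycleAdj?
  ; ~-sym    = swap
  ; ~-irrefl = cycleAdj-irrefl 3≤n
  }

SunVertex : ℕ → Set
SunVertex n = Fin n ⊎ Fin n

pattern v i = inj₁ i
pattern u i = inj₂ i

module _ {n : ℕ} where

  SunAdj : Rel (SunVertex n) 0ℓ
  SunAdj (v i) (v j) = i ≢ j
  SunAdj (u i) (v j) = j ≡ i ⊎ i ⟶ j
  SunAdj (v j) (u i) = j ≡ i ⊎ i ⟶ j
  SunAdj (u i) (u j) = ⊥

  sunAdj? : B.Decidable SunAdj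
  sunAdj? (v i) (v j) = ¬? (i Fin.≟ j)
  sunAdj? (u i) (v j) = (j Fin.≟ i) ⊎-dec (i ⟶? j)
  sunAdj? (v j) (u i) = (j Fin.≟ i) ⊎-dec (i ⟶? j)
  sunAdj? (u i) (u j) = no λ ()

  sunAdj-sym : B.Symmetric SunAdj
  sunAdj-sym {v i} {v j} e = ≢-sym e
  sunAdj-sym {u i} {v j} e = e
  sunAdj-sym {v j} {u i} e = e

  sunAdj-irrefl : ∀ {x} → ¬ SunAdj x x
  sunAdj-irrefl {v i} e = e refl

  OuterAdj : Rel (SunVertex n) 0ℓ
  OuterAdj (u i) (u j) = CycleAdj i j
  OuterAdj (u i) (v j) = ⊥
  OuterAdj (v i) y     = ⊥

  outerAdj? : B.Decidable OuterAdj
  outerAdj? (u i) (u j) = cycleAdj? i j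
  outerAdj? (u i) (v j) = no λ ()
  outerAdj? (v i) y     = no λ ()

  outerAdj-sym : B.Symmetric OuterAdj
  outerAdj-sym {u i} {u j} e = swap e

  outerAdj-irrefl : 3 ≤ n → ∀ {x} → ¬ OuterAdj x x
  outerAdj-irrefl 3≤n {u i} e = cycleAdj-irrefl 3≤n e

sun : ℕ → Graph
sun n = record
  { V        = SunVertex n
  ; order    = n + n
  ; enum     = ↔-sym (Fin.+↔⊎ {n} {n})
  ; _~_      = SunAdj
  ; _~?_     = sunAdj?
  ; ~-sym    = λ {x} {y} → sunAdj-sym {x = x} {y}
  ; ~-irrefl = λ {x} → sunAdj-irrefl {x = x}
  }

closedSun : ∀ n → 3 ≤ n → Graph
closedSun n 3≤n = record
  { V        = S.V
  ; order    = S.order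
  ; enum     = S.enum
  ; _~_      = λ x y → x S.~ y ⊎ OuterAdj x y
  ; _~?_     = λ x y → (x S.~? y) ⊎-dec outerAdj? x y
  ; ~-sym    = λ {x} {y} → map (S.~-sym {x} {y}) (outerAdj-sym {x = x} {y})
  ; ~-irrefl = λ { {x} (inj₁ e) → S.~-irrefl {x} e
                 ; {x} (inj₂ e) → outerAdj-irrefl 3≤n {x} e }
  }
  where module S = Graph (sun n)

{-# OPTIONS --safe #-}

-- A rim vertex uᵢ never reuses a hub color: if uᵢ had the color of vⱼ, then the
-- edges uᵢvᵢ and vⱼvᵢ would have the same colors.  So n colors are spent on the
-- clique, and the remaining ones color the outer cycle harmoniously.
-- Conversely, distinct new colors on the hub extend any harmonious coloring of
-- the cycle, as rim vertices with a common hub neighbor are adjacent.  Hence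
-- h(S̄ₙ) = n + h(Cₙ) for all n ≥ 3, and h(Cₙ) = n for n ≤ 5 because then any two
-- vertices of Cₙ are at distance at most 2.
module Submission where

open import Defs
open import Data.Fin.Base using (Fin; zero; suc; _↑ˡ_; _↑ʳ_; punchOut; splitAt; fromℕ<)
import Data.Fin.Properties as Fin
open import Data.Nat.Base
  using (ℕ; zero; suc; _+_; _*_; _≤_; _>_; z≤n; s≤s; >-nonZero⁻¹)
import Data.Nat.Properties as ℕ
open import Data.Product.Base using (_×_; _,_; proj₁; ∃-syntax; Σ-syntax)
open import Data.Sum.Base using (_⊎_; inj₁; inj₂)
open import Data.Sum.Properties using (inj₂-injective)
open import Function.Base using (_∘_; id)
open import Function.Definitions using (Injective)
open import Relation.Binary.PropositionalEquality
  using (_≡_; _≢_; refl; sym; trans; cong; subst)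
open import Relation.Nullary.Decidable
  using (Dec; yes; no; toWitness; _×-dec_; _⊎-dec_)
open import Relation.Nullary.Negation using (contradiction)

h-unique : ∀ G {k} → IsHarmoniousChromaticNumber G k → h G ≡ k
h-unique G (colorable , minimal) =
  let colorable′ , minimal′ = h-isHarmoniousChromaticNumber G
  in ℕ.≤-antisym (minimal′ _ colorable) (minimal _ colorable′)

module _ (G : Graph) where
  open Graph G

  -- Uniqueness without naming the colors: edges are oriented, and colors are compared endpoint by
  -- endpoint.
  SeparatesEdges : ∀ {k} → Coloring G k → Set
  SeparatesEdges c = ∀ {x y x′ y′} → x ~ y → x′ ~ y′ →
    c x ≡ c x′ → c y ≡ c y′ → x ≡ x′ × y ≡ y′

  separates⇒harmonious : ∀ {k} {c : Coloring G k} →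
    Proper G c → SeparatesEdges c → IsHarmonious G c
  separates⇒harmonious proper sep =
    proper ,
    λ { i j i≢j x y x′ y′ (e , p , q) (e′ , p′ , q′) →
        sep e e′ (trans p (sym p′)) (trans q (sym q′)) }

  harmonious⇒separates : ∀ {k} {c : Coloring G k} →
    IsHarmonious G c → SeparatesEdges c
  -- The colors `i` and `j` are those of the first edge, distinct by properness.
  harmonious⇒separates (proper , unique) e e′ p q =
    unique _ _ (proper _ _ e) _ _ _ _ (e , refl , refl) (e′ , sym p , sym q)

  harmonious⇒common-neighbor : ∀ {k} {c : Coloring G k} → IsHarmonious G c →
    ∀ {x x′ y} → x ~ y → x′ ~ y → c x ≡ c x′ → x ≡ x′
  harmonious⇒common-neighbor harm e e′ p =
    let x≡x′ , _ = harmonious⇒separates harm e e′ p refl in x≡x′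

  injective⇒harmonious : ∀ {k} {c : Coloring G k} →
    Injective _≡_ _≡_ c → IsHarmonious G c
  injective⇒harmonious inj = separates⇒harmonious
    (λ x y e p → ~-irrefl (subst (x ~_) (sym (inj p)) e))
    (λ _ _ p q → inj p , inj q)

-- Induction on `n`: `punchOut` deletes the color `f zero`, which neither the rest of `f` nor `d`
-- takes. Reflecting equality of colors is what carries properness and edge separation over to `d′`.
dropColors : ∀ {A : Set} {n k} (f : Fin n → Fin k) → Injective _≡_ _≡_ f →
  (d : A → Fin k) → (∀ i a → f i ≢ d a) →
  ∃[ m ] k ≡ n + m × Σ[ d′ ∈ (A → Fin m) ] (∀ a b → d′ a ≡ d′ b → d a ≡ d b)
dropColors {n = zero} {k} f inj d disj = k , refl , d , λ _ _ → id
dropColors {n = suc n} {zero} f inj d disj = contradiction (f zero) λ ()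
dropColors {n = suc n} {suc k} f inj d disj =
  let m , k≡n+m , d″ , reflects = dropColors
        (λ i → punchOut (f0≢ i))
        (λ {i} {j} p →
          Fin.suc-injective (inj (Fin.punchOut-injective (f0≢ i) (f0≢ j) p)))
        (λ a → punchOut (disj zero a))
        (λ i a p → disj (suc i) a
          (Fin.punchOut-injective (f0≢ i) (disj zero a) p))
  in m , cong suc k≡n+m , d″ , λ a b p →
       Fin.punchOut-injective (disj zero a) (disj zero b) (reflects a b p)
  where
  f0≢ : ∀ i → f zero ≢ f (suc i)
  f0≢ i p = Fin.0≢1+n (inj p)

⟶-injective : ∀ {n} {i i′ j : Fin n} → i ⟶ j → i′ ⟶ j → i ≡ i′
⟶-injective (inj₁ p) (inj₁ q) =
  Fin.toℕ-injective (ℕ.suc-injective (trans (sym p) q))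
⟶-injective (inj₁ p) (inj₂ (_ , q)) = contradiction (trans (sym p) q) λ ()
⟶-injective (inj₂ (_ , p)) (inj₁ q) = contradiction (trans (sym q) p) λ ()
⟶-injective (inj₂ (p , _)) (inj₂ (q , _)) =
  Fin.toℕ-injective (ℕ.suc-injective (trans p (sym q)))

-- The rim neighbors of `v j` are `u j` and `u` of the cyclic predecessor of `j`, consecutive on the
-- outer cycle.
common-hub⇒adjacent : ∀ {n} {i i′ j : Fin n} →
  SunAdj (v j) (u i) → SunAdj (v j) (u i′) → i ≡ i′ ⊎ CycleAdj i i′
common-hub⇒adjacent (inj₁ refl) (inj₁ refl) = inj₁ refl
common-hub⇒adjacent (inj₁ refl) (inj₂ q)    = inj₂ (inj₂ q)
common-hub⇒adjacent (inj₂ p)    (inj₁ refl) = inj₂ (inj₁ p)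
common-hub⇒adjacent (inj₂ p)    (inj₂ q)    = inj₁ (⟶-injective p q)

module _ {n : ℕ} (3≤n : 3 ≤ n) where
  private
    C = cycle n 3≤n
    S = closedSun n 3≤n

  module _ {k : ℕ} {c : Coloring S k} (harm : IsHarmonious S c) where

    hub-injective : Injective _≡_ _≡_ (c ∘ v)
    hub-injective {i} {j} p with i Fin.≟ j
    ... | yes i≡j = i≡j
    ... | no  i≢j = contradiction p (proj₁ harm _ _ (inj₁ i≢j))

    hub≢rim : ∀ j i → c (v j) ≢ c (u i)
    hub≢rim j i p with j Fin.≟ i
    ... | yes refl = proj₁ harm (v i) (u i) (inj₁ (inj₁ refl)) p
    -- `v j` and `u i` share the neighbor `v i`, so equal colors would make a hub vertex equal to a
    -- rim vertex.
    ... | no  j≢i  = contradiction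
      (harmonious⇒common-neighbor S harm {v j} {u i} {v i}
        (inj₁ j≢i) (inj₁ (inj₁ refl)) p)
      λ ()

  restrict : ∀ {k} → HarmoniouslyColorable S k →
    ∃[ m ] k ≡ n + m × HarmoniouslyColorable C m
  restrict (c , harm) =
    let m , k≡n+m , d , reflects =
          dropColors (c ∘ v) (hub-injective harm) (c ∘ u) (hub≢rim harm)
    in m , k≡n+m , d , separates⇒harmonious C
         (λ x y e p → proj₁ harm (u x) (u y) (inj₂ e) (reflects x y p))
         (λ e e′ p q →
           let r , s = harmonious⇒separates S harm (inj₂ e) (inj₂ e′)
                         (reflects _ _ p) (reflects _ _ q)
           in inj₂-injective r , inj₂-injective s)

  module _ {m : ℕ} {c : Coloring C m} (harm : IsHarmonious C c) where
    private
      extended : Coloring S (n + m)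
      extended (v i) = i ↑ˡ m
      extended (u i) = n ↑ʳ c i

      v≢u : ∀ {i j} → extended (v i) ≢ extended (u j)
      v≢u {i} {j} p = contradiction
        (trans (sym (Fin.splitAt-↑ˡ n i m))
          (trans (cong (splitAt n) p) (Fin.splitAt-↑ʳ n m (c j))))
        λ ()

      v-inj : ∀ {i j} → extended (v i) ≡ extended (v j) → i ≡ j
      v-inj = Fin.↑ˡ-injective m _ _

      u-inj : ∀ {i j} → extended (u i) ≡ extended (u j) → c i ≡ c j
      u-inj = Fin.↑ʳ-injective n _ _

      rim : ∀ {i i′ j} → SunAdj (v j) (u i) → SunAdj (v j) (u i′) →
            c i ≡ c i′ → i ≡ i′
      rim e e′ p with common-hub⇒adjacent e e′
      ... | inj₁ i≡i′ = i≡i′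
      ... | inj₂ adj  = contradiction p (proj₁ harm _ _ adj)

      proper : Proper S extended
      proper (v i) (v j) (inj₁ e) p = e (v-inj p)
      proper (v i) (u j) _        p = v≢u p
      proper (u i) (v j) _        p = v≢u (sym p)
      proper (u i) (u j) (inj₂ e) p = proj₁ harm i j e (u-inj p)

      -- Hub and rim colors lie in disjoint blocks, so corresponding endpoints are of the same kind.
      -- This leaves two clique edges, two spokes with the same hub end, or two outer edges.
      separates : SeparatesEdges S extended
      separates {v _} {_}   {u _} {_}   _ _ p _ = contradiction p v≢u
      separates {u _} {_}   {v _} {_}   _ _ p _ = contradiction (sym p) v≢u
      separates {_}   {v _} {_}   {u _} _ _ _ q = contradiction q v≢u
      separates {_}   {u _} {_}   {v _} _ _ _ q = contradiction (sym q) v≢u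
      separates {v _} {v _} {v _} {v _} _ _ p q =
        cong v (v-inj p) , cong v (v-inj q)
      separates {v _} {u _} {v _} {u _} (inj₁ e) (inj₁ e′) p q
        with refl ← v-inj p = refl , cong u (rim e e′ (u-inj q))
      separates {u _} {v _} {u _} {v _} (inj₁ e) (inj₁ e′) p q
        with refl ← v-inj q = cong u (rim e e′ (u-inj p)) , refl
      separates {u _} {u _} {u _} {u _} (inj₂ e) (inj₂ e′) p q =
        let r , s = harmonious⇒separates C harm e e′ (u-inj p) (u-inj q)
        in cong u r , cong u s

    extend : HarmoniouslyColorable S (n + m)
    extend = extended , separates⇒harmonious S proper separates

  h-closedSun : h S ≡ n + h C
  h-closedSun =
    let (1≤h , c , harm) , minimal = h-isHarmoniousChromaticNumber C in
    h-unique S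
    ( (ℕ.≤-trans 1≤h (ℕ.m≤n+m (h C) n) , extend harm)
    , λ { j (_ , colorable) →
          let m , j≡n+m , d , harm′ = restrict colorable in
          subst (n + h C ≤_) (sym j≡n+m)
            -- Minimality of `h C` is only among positive numbers of colors, hence `nonempty`.
            (ℕ.+-monoʳ-≤ n (minimal m (nonempty d , d , harm′))) })
    where
    nonempty : ∀ {m} → (Fin n → Fin m) → 1 ≤ m
    -- Read as `2 < n`, `3≤n` provides a vertex, whose color shows that `Fin m` is inhabited.
    nonempty d = >-nonZero⁻¹ _ {{Fin.nonZeroIndex (d (fromℕ< 3≤n))}}

-- Both edges of a path of length 2 point to its midpoint `z`, the form that
-- `harmonious⇒common-neighbor` takes.
DistanceAtMost2 : ∀ {n} → Fin n → Fin n → Set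
DistanceAtMost2 x y =
  x ≡ y ⊎ CycleAdj x y ⊎ ∃[ z ] CycleAdj x z × CycleAdj y z

diameter≤2? : ∀ n → Dec (∀ (x y : Fin n) → DistanceAtMost2 x y)
diameter≤2? n = Fin.all? λ x → Fin.all? λ y →
  (x Fin.≟ y) ⊎-dec cycleAdj? x y ⊎-dec
  Fin.any? λ z → cycleAdj? x z ×-dec cycleAdj? y z

-- Vertices at distance 1 differ in color by properness, those at distance 2 by their common
-- neighbor. So every harmonious coloring is injective, and the identity is optimal.
h-cycle : ∀ {n} (3≤n : 3 ≤ n) → (∀ (x y : Fin n) → DistanceAtMost2 x y) →
          h (cycle n 3≤n) ≡ n
h-cycle {n} 3≤n diameter≤2 = h-unique C
  ( (ℕ.≤-trans (s≤s z≤n) 3≤n , id , injective⇒harmonious C id)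
  , λ { j (_ , c , harm) → Fin.injective⇒≤ (injective harm) })
  where
  C = cycle n 3≤n

  injective : ∀ {j} {c : Coloring C j} → IsHarmonious C c → Injective _≡_ _≡_ c
  injective harm {x} {y} p with diameter≤2 x y
  ... | inj₁ x≡y                 = x≡y
  ... | inj₂ (inj₁ e)            = contradiction p (proj₁ harm x y e)
  ... | inj₂ (inj₂ (z , e , e′)) = harmonious⇒common-neighbor C harm e e′ p

cycle-diameter≤2 : ∀ {n} → 3 ≤ n → n ≤ 5 →
                   ∀ (x y : Fin n) → DistanceAtMost2 x y
-- The three cases are settled by evaluating the decision procedure.
cycle-diameter≤2 {3} _ _ = toWitness {a? = diameter≤2? 3} _
cycle-diameter≤2 {4} _ _ = toWitness {a? = diameter≤2? 4} _
cycle-diameter≤2 {5} _ _ = toWitness {a? = diameter≤2? 5} _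
cycle-diameter≤2 {1} (s≤s ()) _
cycle-diameter≤2 {2} (s≤s (s≤s ())) _
cycle-diameter≤2 {suc (suc (suc (suc (suc (suc n)))))} _
  (s≤s (s≤s (s≤s (s≤s (s≤s ())))))

theorem22 : (n : ℕ) (3≤n : 3 ≤ n) →
    (n ≤ 5 → h (closedSun n 3≤n) ≡ 2 * n) ×
    (n > 5 → h (closedSun n 3≤n) ≡ n + h (cycle n 3≤n))
theorem22 n 3≤n =
  (λ n≤5 → trans (h-closedSun 3≤n)
    -- `2 * n` unfolds to `n + (n + 0)`.
    (cong (n +_) (trans (h-cycle 3≤n (cycle-diameter≤2 3≤n n≤5))
                        (sym (ℕ.+-identityʳ n))))) ,
  λ _ → h-closedSun 3≤n
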